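{- For every positive integer $k$, there are graphs $G_k$ and $H_k$ such that $\chi_{\nleftrightarrow}(G_k) - \mathrm{ch}(G_k) \geq k$ and $\mathrm{ch}(H_k) - \chi_{\nleftrightarrow}(H_k) \geq k$.
   Context: Graphs are finite and simple. $\mathrm{ch}(G)$ denotes the choice number (list-chromatic number) of $G$: the minimum $k$ such that for every assignment of lists $L(v)$ of at least $k$ colors to the vertices, $G$ has a proper vertex coloring $\varphi$ with $\varphi(v)\in L(v)$ for all $v$. A local $k$-partition of a graph $G$ is a collection $\{c_v\}_{v\in V(G)}$ of maps $c_v : E(v)\to\{1,\dots,k\}$, where $E(v)$ is the set of edges incident with $v$. $G$ is conflict $\{c_v\}$-colorable if there is a map $\varphi : V(G)\to\{1,\dots,k\}$ such that no edge $e=xy$ satisfies both $\varphi(x)=c_x(e)$ and $\varphi(y)=c_y(e)$. The single conflict chromatic number $\chi_{\nleftrightarrow}(G)$ is the smallest $k$ such that $G$ is conflict $\{c_v\}$-colorable for every local $k$-partition $\{c_v\}$. -}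

module Defs where

open import Data.Bool using (Bool; T)
open import Data.Fin using (Fin)
open import Data.List using (List; length)
open import Data.List.Membership.Propositional using (_∈_)
open import Data.List.Relation.Unary.Unique.Propositional using (Unique)
open import Data.Nat using (ℕ; _≤_)
open import Data.Product using (Σ-syntax; ∃-syntax; _×_; _,_)
open import Relation.Binary.PropositionalEquality using (_≡_; _≢_)
open import Relation.Nullary using (¬_)

-- Adjacency is Bool-valued so that T (adj x y) has at most one proof:
-- the graph has no parallel edges.
record Graph : Set where
  field
    order      : ℕ
    adj        : Fin order → Fin order → Bool
    adj-sym    : ∀ x y → T (adj x y) → T (adj y x)
    adj-irrefl : ∀ x → ¬ T (adj x x)

  Vertex : Set
  Vertex = Fin order

  Adj : Vertex → Vertex → Set
  Adj x y = T (adj x y)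

  -- E(v): in a simple graph an edge incident with v is determined by its
  -- other endpoint.
  IncidentEdge : Vertex → Set
  IncidentEdge v = Σ[ w ∈ Vertex ] Adj v w

-- k is the least positive integer satisfying P.  Positivity matters for the
-- single conflict chromatic number: a graph with an edge has no local
-- 0-partition, so it would satisfy the defining condition vacuously at k = 0.
IsLeastPositive : (ℕ → Set) → ℕ → Set
IsLeastPositive P k = 1 ≤ k × P k × (∀ j → 1 ≤ j → P j → k ≤ j)

module _ (G : Graph) where
  open Graph G

  ProperColoring : (Vertex → ℕ) → Set
  ProperColoring φ = ∀ x y → Adj x y → φ x ≢ φ y

  -- Colors are natural numbers; a list of colors is a finite set, represented
  -- by a duplicate-free List, so its length is its number of colors.
  Choosable : ℕ → Set
  Choosable k =
    (L : Vertex → List ℕ) →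
    (∀ v → Unique (L v)) →
    (∀ v → k ≤ length (L v)) →
    ∃[ φ ] ProperColoring φ × (∀ v → φ v ∈ L v)

  IsChoiceNumber : ℕ → Set
  IsChoiceNumber = IsLeastPositive Choosable

  -- Fin k plays the role of {1,…,k}.
  LocalPartition : ℕ → Set
  LocalPartition k = (v : Vertex) → IncidentEdge v → Fin k

  -- The edge e = xy is (y , e) as a member of E(x) and (x , _) as a member
  -- of E(y).
  ConflictColorable : (k : ℕ) → LocalPartition k → Set
  ConflictColorable k c =
    Σ[ φ ∈ (Vertex → Fin k) ]
      (∀ x y (e : Adj x y) →
        ¬ (φ x ≡ c x (y , e) × φ y ≡ c y (x , adj-sym x y e)))

  IsSingleConflictChromaticNumber : ℕ → Set
  IsSingleConflictChromaticNumber =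
    IsLeastPositive (λ k → (c : LocalPartition k) → ConflictColorable k c)

{-# OPTIONS --safe #-}
module Submission where

-- All three bounds come from one derandomised first-moment argument: if a
-- uniformly random function c leaves, in expectation, less than one item
-- unserved, then some c serves every item.
--   * K_{n,n} with 2n < 2^t is t-choosable: each colour is assigned to one of the
--     two sides, and a vertex is served by a colour of its list given to its side.
--   * K_{n,n} has a local K-partition hitting each of the K^(2n) colourings as
--     soon as K^(2n) (1 - 1/K²)^(n²) < 1: each edge is assigned a forbidden pair.
--     With K = 2^r and n = 2^(3r+1) this gives χ > 2^r, while ch ≤ 3r + 3.
--   * K_N, and so every graph on N vertices, is conflict m-colourable once
--     N(N-1)/2 < m²: a random colouring has fewer than one conflicting edge.
--     With N = 4k and m = 3k this gives χ ≤ 3k, while ch = 4k.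
-- Both parameters are decidable on a given graph, so the least values exist.

open import Data.Nat using (ℕ) renaming (_≤_ to _≤ℕ_)
open import Data.Integer using (+_; _-_; _≥_)
open import Data.Product using (Σ-syntax; ∃-syntax; _×_)
open import Defs

import Algebra.Properties.CommutativeMonoid.Sum as CMSum
import Data.Integer as ℤ
import Data.Integer.Properties as ℤₚ
import Data.List.Properties as Listₚ
import Data.Sum as Sum
import Data.Vec.Functional as Vector
open import Data.Bool using (if_then_else_)
open import Data.Bool.Properties using (T-irrelevant; T?)
open import Data.Fin
  using (Fin; zero; suc; _≟_; splitAt; combine; remQuot; finToFun; funToFin; _↑ˡ_; _↑ʳ_; toℕ; fromℕ<; inject≤)
open import Data.Fin.Properties
  using (suc-injective; splitAt-↑ˡ; splitAt-↑ʳ; remQuot-combine; combine-remQuot; finToFun-funToFin; any?; all?;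
         toℕ-injective; toℕ-fromℕ<; toℕ<n; toℕ-inject≤; inject≤-injective; injective⇒≤)
open import Data.List as List using (List; []; _∷_; length; upTo)
open import Data.List.Extrema.Nat using (max; xs≤max)
open import Data.List.Membership.Propositional using (_∈_)
open import Data.List.Membership.Propositional.Properties
  using (∈-tabulate⁺; ∈-tabulate⁻; ∈-concat⁺′; ∈-lookup; ∈-upTo⁻)
open import Data.List.Relation.Unary.All as All using ()
open import Data.List.Relation.Unary.AllPairs using ([]; _∷_)
open import Data.List.Relation.Unary.Any using (here; there)
open import Data.List.Relation.Unary.Unique.Propositional using (Unique)
open import Data.List.Relation.Unary.Unique.Propositional.Properties using (upTo⁺; tabulate⁺)
open import Data.Nat as ℕ hiding (_≟_; _≥_)
open import Data.Nat.Properties renaming (_≟_ to _≟ℕ_) hiding (suc-injective)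
open import Data.Nat.Solver using (module +-*-Solver)
open import Data.List.Membership.DecPropositional _≟ℕ_ using (_∈?_)
open import Data.Product using (_,_; proj₁; proj₂; map; uncurry)
open import Data.Sum using (_⊎_; inj₁; inj₂; [_,_]′)
open import Function using (_∘_; id; _$_)
open import Relation.Binary.PropositionalEquality
open import Relation.Nullary using (Dec; yes; no; does; ¬_; contradiction)
open import Relation.Nullary.Decidable
  using (dec-true; decidable-stable; _×-dec_; _⊎-dec_; _→-dec_; ¬?; isNo; toWitnessFalse; fromWitnessFalse; map′)

open import Algebra.Properties.Semiring.Sum +-*-semiring
  using (sum; sum-cong-≗; ∑-comm; *-distribˡ-sum; *-distribʳ-sum; sum-replicate-zero)
open CMSum *-1-commutativeMonoid
  using ()
  renaming (sum to prod; ∑-distrib-+ to prod-distrib-*; sum-cong-≗ to prod-cong-≗;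
            sum-replicate-zero to prod-replicate-one)

-- Sums and products over finite index sets.

sum-mono : ∀ {n} {f g : Fin n → ℕ} → (∀ i → f i ≤ g i) → sum f ≤ sum g
sum-mono {zero}  f≤g = z≤n
sum-mono {suc n} f≤g = +-mono-≤ (f≤g zero) (sum-mono (f≤g ∘ suc))

prod-mono : ∀ {n} {f g : Fin n → ℕ} → (∀ i → f i ≤ g i) → prod f ≤ prod g
prod-mono {zero}  f≤g = ≤-refl
prod-mono {suc n} f≤g = *-mono-≤ (f≤g zero) (prod-mono (f≤g ∘ suc))

sum-const : ∀ n a → sum {n} (λ _ → a) ≡ n * a
sum-const zero    a = refl
sum-const (suc n) a = cong (a ℕ.+_) (sum-const n a)

prod-const : ∀ n a → prod {n} (λ _ → a) ≡ a ^ n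
prod-const zero    a = refl
prod-const (suc n) a = cong (a *_) (prod-const n a)

sum≡0 : ∀ {n} {f : Fin n → ℕ} → sum f ≡ 0 → ∀ i → f i ≡ 0
sum≡0 {suc n} {f} eq zero    = m+n≡0⇒m≡0 (f zero) eq
sum≡0 {suc n} {f} eq (suc i) = sum≡0 (m+n≡0⇒n≡0 (f zero) eq) i

prod≡0 : ∀ {n} {f : Fin n → ℕ} → prod f ≡ 0 → ∃[ i ] f i ≡ 0
prod≡0 {suc n} {f} eq with m*n≡0⇒m≡0∨n≡0 (f zero) eq
... | inj₁ p = zero , p
... | inj₂ p with i , q ← prod≡0 p = suc i , q

sum-single : ∀ {n} (x : Fin n) a → sum (λ i → if does (i ≟ x) then a else 0) ≡ a
sum-single {suc n} zero    a = trans (cong (a ℕ.+_) (sum-replicate-zero n)) (+-identityʳ a)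
sum-single {suc n} (suc x) a = sum-single x a

-- Read from right to left, this spreads a constant over all indices, so that an inequality between
-- products can be checked factor by factor.
prod-single : ∀ {n} (x : Fin n) a → prod (λ i → if does (i ≟ x) then a else 1) ≡ a
prod-single {suc n} zero    a = trans (cong (a *_) (prod-replicate-one n)) (*-identityʳ a)
prod-single {suc n} (suc x) a = trans (+-identityʳ _) (prod-single x a)

-- First-moment method by conditional expectations.

below-average : ∀ q {X} (g : Fin q → ℕ) → sum g < q * X → ∃[ l ] g l < X
below-average (suc q) {X} g Σ<  with g zero <? X
... | yes p = zero , p
... | no  p with l , r ← below-average q (g ∘ suc)
                (+-cancelˡ-< X _ _ (≤-<-trans (+-monoˡ-≤ _ (≮⇒≥ p)) Σ<)) = suc l , r

-- The values of `c` are fixed one at a time: `u s` collects the weight of s under the choices made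
-- so far, and the product of sums accounts for the open ones. Some next value keeps the total below
-- the number of completions. With nothing left open, the total is a natural number below 1, so
-- every term vanishes.
low-weight-choice : ∀ M {q N} (w : Fin M → Fin q → Fin N → ℕ) (u : Fin N → ℕ) →
  sum (λ s → u s * prod (λ e → sum (λ l → w e l s))) < q ^ M →
  Σ[ c ∈ (Fin M → Fin q) ] ∀ s → u s * prod (λ e → w e (c e) s) ≡ 0
low-weight-choice zero w u Σ< = (λ ()) , sum≡0 (n<1⇒n≡0 Σ<)
low-weight-choice (suc M) {q} {N} w u Σ< with below-average q (λ l → sum (rest l)) (subst (_< q * q ^ M) regroup Σ<)
  where
  tailProd : Fin N → ℕ
  tailProd s = prod (λ e → sum (λ l → w (suc e) l s))
  rest : Fin q → Fin N → ℕ
  rest l s = u s * w zero l s * tailProd s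
  regroup : sum (λ s → u s * (sum (λ l → w zero l s) * tailProd s)) ≡ sum (λ l → sum (rest l))
  regroup = trans (sum-cong-≗ λ s → begin
      u s * (sum (λ l → w zero l s) * tailProd s)  ≡⟨ *-assoc (u s) _ _ ⟨
      u s * sum (λ l → w zero l s) * tailProd s    ≡⟨ cong (_* tailProd s) (*-distribˡ-sum (u s) (λ l → w zero l s)) ⟩
      sum (λ l → u s * w zero l s) * tailProd s    ≡⟨ *-comm _ (tailProd s) ⟩
      tailProd s * sum (λ l → u s * w zero l s)    ≡⟨ *-distribˡ-sum (tailProd s) (λ l → u s * w zero l s) ⟩
      sum (λ l → tailProd s * (u s * w zero l s))  ≡⟨ sum-cong-≗ {q} (λ l → *-comm (tailProd s) _) ⟩
      sum (λ l → rest l s)                         ∎)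
    (∑-comm (λ s l → rest l s))
    where open ≡-Reasoning
... | l , Σl< with c , dead ← low-weight-choice M (w ∘ suc) (λ s → u s * w zero l s) Σl< =
  l Vector.∷ c , λ s → trans (sym (*-assoc (u s) _ _)) (dead s)

-- Success has weight 0, so a product of such weights vanishes exactly when some factor succeeds.
unless : ∀ {p} {P : Set p} → Dec P → ℕ
unless d = if does d then 0 else 1

unless≡0 : ∀ {p} {P : Set p} (d : Dec P) → unless d ≡ 0 → P
unless≡0 (yes p) _ = p

unless≤1 : ∀ {p} {P : Set p} (d : Dec P) → unless d ≤ 1
unless≤1 (yes _) = z≤n
unless≤1 (no  _) = ≤-refl

sum-unless≤ : ∀ {n} {P : Fin n → Set} (P? : ∀ i → Dec (P i)) → sum (λ i → unless (P? i)) ≤ n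
sum-unless≤ {n} P? = ≤-trans (sum-mono (λ i → unless≤1 (P? i))) (≤-reflexive (trans (sum-const n 1) (*-identityʳ n)))

sum-unless≤1 : ∀ {n} {P : Fin n → Set} (P? : ∀ i → Dec (P i)) x →
  (∀ i → i ≢ x → P i) → sum (λ i → unless (P? i)) ≤ 1
sum-unless≤1 P? x h = ≤-trans (sum-mono bound) (≤-reflexive (sum-single x 1))
  where
  bound : ∀ i → unless (P? i) ≤ (if does (i ≟ x) then 1 else 0)
  bound i with i ≟ x
  ... | yes _  = unless≤1 (P? i)
  ... | no i≢x = ≤-reflexive (cong (if_then 0 else 1) (dec-true (P? i) (h i i≢x)))

sum-unless≡ : ∀ {q} (x : Fin q) → sum (λ i → unless (i ≟ x)) ≡ pred q
sum-unless≡ {suc p}       zero    = trans (sum-const p 1) (*-identityʳ p)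
sum-unless≡ {suc (suc p)} (suc x) = cong suc (sum-unless≡ x)

module _ {M q N} {Hit : Fin M → Fin q → Fin N → Set} (Hit? : ∀ e l s → Dec (Hit e l s)) where

  misses : Fin M → Fin N → ℕ
  misses e s = sum (λ l → unless (Hit? e l s))

  -- Under a uniformly random c, the expected number of s that are never hit is
  -- (Σ_s Π_e misses e s) / q ^ M; the hypothesis makes it smaller than 1.
  hitting-choice : sum (λ s → prod (λ e → misses e s)) < q ^ M →
    Σ[ c ∈ (Fin M → Fin q) ] ∀ s → ∃[ e ] Hit e (c e) s
  hitting-choice Σ< with c , dead ← low-weight-choice M (λ e l s → unless (Hit? e l s)) (λ _ → 1)
      (subst (_< q ^ M) (sum-cong-≗ {N} (λ s → sym (*-identityˡ _))) Σ<) =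
    c , λ s → let e , eq = prod≡0 (trans (sym (*-identityˡ _)) (dead s)) in
      e , unless≡0 (Hit? e (c e) s) eq

-- Unordered pairs and conflict-free colourings of complete graphs.

pairCount : ℕ → ℕ
pairCount zero    = 0
pairCount (suc n) = n + pairCount n

pairCount-double : ∀ n → 2 * pairCount n + n ≡ n * n
pairCount-double zero    = refl
pairCount-double (suc n) = begin
  2 * (n + pairCount n) + suc n        ≡⟨ solve 2 (λ n p → con 2 :* (n :+ p) :+ (con 1 :+ n) := con 1 :+ n :+ (con 2 :* p :+ n) :+ n) refl n (pairCount n) ⟩
  suc n + (2 * pairCount n + n) + n    ≡⟨ cong (λ z → suc n + z + n) (pairCount-double n) ⟩
  suc n + n * n + n                    ≡⟨ solve 1 (λ n → con 1 :+ n :+ n :* n :+ n := (con 1 :+ n) :* (con 1 :+ n)) refl n ⟩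
  suc n * suc n                        ∎
  where
  open ≡-Reasoning
  open +-*-Solver

-- Follows the recursion of `pairCount`, which is n choose 2: first the pairs containing `zero`,
-- then the others, each unordered pair once.
pair : ∀ n → Fin (pairCount n) → Fin n × Fin n
pair (suc n) s = [ (λ i → zero , suc i) , (λ t → map suc suc (pair n t)) ]′ (splitAt n s)

pair-distinct : ∀ n s → proj₁ (pair n s) ≢ proj₂ (pair n s)
pair-distinct (suc n) s with splitAt n s
... | inj₁ i = λ ()
... | inj₂ t = pair-distinct n t ∘ suc-injective

pair-covers : ∀ n {x y} → x ≢ y → ∃[ s ] (pair n s ≡ (x , y) ⊎ pair n s ≡ (y , x))
pair-covers (suc n) {zero}  {zero}  x≢y = contradiction refl x≢y
pair-covers (suc n) {zero}  {suc y} x≢y =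
  y ↑ˡ pairCount n , inj₁ (cong [ _ , _ ]′ (splitAt-↑ˡ n y (pairCount n)))
pair-covers (suc n) {suc x} {zero}  x≢y =
  x ↑ˡ pairCount n , inj₂ (cong [ _ , _ ]′ (splitAt-↑ˡ n x (pairCount n)))
pair-covers (suc n) {suc x} {suc y} x≢y with t , eq ← pair-covers n (x≢y ∘ cong suc) =
  n ↑ʳ t , Sum.map lift lift eq
  where
  lift : ∀ {uv} → pair n t ≡ uv → pair (suc n) (n ↑ʳ t) ≡ map suc suc uv
  lift eq = trans (cong [ _ , _ ]′ (splitAt-↑ʳ n (pairCount n) t)) (cong (map suc suc) eq)

module _ {n m} (c : Fin n → Fin n → Fin m) where

  -- The items to be hit are the pairs of vertices. A pair is safe once one endpoint avoids its own
  -- forbidden colour; naming that endpoint `e` makes this a hit by a single coordinate of the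
  -- colouring.
  AvoidsAt : Fin n → Fin m → Fin n × Fin n → Set
  AvoidsAt e l (x , y) = (e ≡ x × l ≢ c x y) ⊎ (e ≡ y × l ≢ c y x)

  avoidsAt? : ∀ e l xy → Dec (AvoidsAt e l xy)
  avoidsAt? e l (x , y) = (e ≟ x ×-dec ¬? (l ≟ c x y)) ⊎-dec (e ≟ y ×-dec ¬? (l ≟ c y x))

  private
    at : Fin n → Fin n → ℕ
    at x e = if does (e ≟ x) then m else 1

    missCount : Fin n × Fin n → Fin n → ℕ
    missCount xy e = sum (λ l → unless (avoidsAt? e l xy))

    missCount≤m : ∀ xy e → missCount xy e ≤ m
    missCount≤m xy e = sum-unless≤ (λ l → avoidsAt? e l xy)

    missCount-fst : ∀ x y → missCount (x , y) x ≤ 1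
    missCount-fst x y = sum-unless≤1 (λ l → avoidsAt? x l (x , y)) (c x y) (λ _ l≢ → inj₁ (refl , l≢))

    missCount-snd : ∀ x y → missCount (x , y) y ≤ 1
    missCount-snd x y = sum-unless≤1 (λ l → avoidsAt? y l (x , y)) (c y x) (λ _ l≢ → inj₂ (refl , l≢))

    missCount-bound : ∀ {x y} → x ≢ y → ∀ e → missCount (x , y) e * (at x e * at y e) ≤ m
    missCount-bound {x} {y} x≢y e = bound (e ≟ x) (e ≟ y)
      where
      open ≤-Reasoning
      K = missCount (x , y) e
      bound : (dx : Dec (e ≡ x)) (dy : Dec (e ≡ y)) →
        K * ((if does dx then m else 1) * (if does dy then m else 1)) ≤ m
      bound (yes refl) (yes refl) = contradiction refl x≢y
      bound (yes refl) (no _) = begin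
        K * (m * 1)  ≤⟨ *-monoˡ-≤ (m * 1) (missCount-fst x y) ⟩
        1 * (m * 1)  ≡⟨ trans (*-identityˡ _) (*-identityʳ m) ⟩
        m            ∎
      bound (no _) (yes refl) = begin
        K * (1 * m)  ≤⟨ *-monoˡ-≤ (1 * m) (missCount-snd x y) ⟩
        1 * (1 * m)  ≡⟨ trans (*-identityˡ _) (*-identityˡ m) ⟩
        m            ∎
      bound (no _) (no _) = ≤-trans (≤-reflexive (*-identityʳ K)) (missCount≤m (x , y) e)

    -- At most one value at x and one at y miss the pair, so at most a fraction 1/m² of the
    -- colourings does. The factors of `at x` and of `at y` multiply to m each, which states the
    -- bound without division.
    missProd-bound : ∀ {x y} → x ≢ y → prod (missCount (x , y)) * (m * m) ≤ m ^ n
    missProd-bound {x} {y} x≢y = begin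
      prod f * (m * m)                          ≡⟨ cong₂ (λ a b → prod f * (a * b)) (prod-single x m) (prod-single y m) ⟨
      prod f * (prod (at x) * prod (at y))      ≡⟨ cong (prod f *_) (prod-distrib-* (at x) (at y)) ⟨
      prod f * prod (λ e → at x e * at y e)     ≡⟨ prod-distrib-* f (λ e → at x e * at y e) ⟨
      prod (λ e → f e * (at x e * at y e))      ≤⟨ prod-mono (missCount-bound x≢y) ⟩
      prod {n} (λ _ → m)                        ≡⟨ prod-const n m ⟩
      m ^ n                                     ∎
      where
      open ≤-Reasoning
      f = missCount (x , y)

  conflict-free-choice : pairCount n < m * m →
    Σ[ φ ∈ (Fin n → Fin m) ] ∀ x y → x ≢ y → ¬ (φ x ≡ c x y × φ y ≡ c y x)
  conflict-free-choice few = φ , avoids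
    where
    total : sum (λ s → prod (missCount (pair n s))) < m ^ n
    total = *-cancelʳ-< (m * m) _ _ $ begin-strict
      sum F * (m * m)                       ≡⟨ *-distribʳ-sum (m * m) F ⟩
      sum (λ s → F s * (m * m))             ≤⟨ sum-mono (λ s → missProd-bound (pair-distinct n s)) ⟩
      sum {pairCount n} (λ _ → m ^ n)       ≡⟨ sum-const (pairCount n) (m ^ n) ⟩
      pairCount n * m ^ n                   <⟨ *-monoˡ-< (m ^ n) {{m^n≢0 m n {{m-nonZero}}}} few ⟩
      m * m * m ^ n                         ≡⟨ *-comm (m * m) (m ^ n) ⟩
      m ^ n * (m * m)                       ∎
      where
      open ≤-Reasoning
      F = λ s → prod (missCount (pair n s))
      m-nonZero : NonZero m
      m-nonZero = m*n≢0⇒m≢0 m {{>-nonZero (≤-<-trans z≤n few)}}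

    choice = hitting-choice (λ e l s → avoidsAt? e l (pair n s)) total
    φ = proj₁ choice

    avoids : ∀ x y → x ≢ y → ¬ (φ x ≡ c x y × φ y ≡ c y x)
    -- The enumeration holds only one of (x, y) and (y, x), and the hit may be at either endpoint.
    avoids x y x≢y (p , q) with s , eq ← pair-covers n x≢y with proj₂ choice s | eq
    ... | e , hit | inj₁ eq with subst (AvoidsAt e (φ e)) eq hit
    ...   | inj₁ (refl , r) = r p
    ...   | inj₂ (refl , r) = r q
    avoids x y x≢y (p , q) | e , hit | inj₂ eq with subst (AvoidsAt e (φ e)) eq hit
    ...   | inj₁ (refl , r) = r q
    ...   | inj₂ (refl , r) = r p

-- Exhaustive search over functions, and least values.

all-functions? : ∀ {m n p} {P : (Fin n → Fin m) → Set p} → (∀ {f g} → f ≗ g → P f → P g) →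
  (∀ f → Dec (P f)) → Dec (∀ f → P f)
all-functions? resp P? = map′
  -- Decoding the code of f returns f only pointwise; `resp` transports along that.
  (λ h f → resp (finToFun-funToFin f) (h (funToFin f)))
  (λ h → h ∘ finToFun)
  (all? (P? ∘ finToFun))

any-function? : ∀ {m n p} {P : (Fin n → Fin m) → Set p} → (∀ {f g} → f ≗ g → P f → P g) →
  (∀ f → Dec (P f)) → Dec (Σ[ f ∈ (Fin n → Fin m) ] P f)
any-function? resp P? = map′
  (λ (s , p) → finToFun s , p)
  (λ (f , p) → funToFin f , resp (sym ∘ finToFun-funToFin f) p)
  (any? (P? ∘ finToFun))

leastPositive : ∀ {P : ℕ → Set} → (∀ j → Dec (P (suc j))) → ∀ b → 1 ≤ b → P b → ∃[ k ] IsLeastPositive P k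
leastPositive {P} P? b 1≤b Pb = search b 0 (λ _ 1≤j j≤0 → contradiction 1≤j (<⇒≱ (s≤s j≤0))) (≤-reflexive (sym (+-identityʳ b)))
  where
  -- Linear search upwards: no positive number up to i satisfies P, and b is at most `fuel + i`, so
  -- running out of fuel contradicts `P b`.
  search : ∀ fuel i → (∀ j → 1 ≤ j → j ≤ i → ¬ P j) → b ≤ fuel + i → ∃[ k ] IsLeastPositive P k
  search zero i none b≤i = contradiction Pb (none b 1≤b b≤i)
  search (suc fuel) i none b≤ with P? i
  ... | yes p = suc i , s≤s z≤n , p , λ j 1≤j Pj → ≰⇒> (λ j≤i → none j 1≤j j≤i Pj)
  ... | no ¬p = search fuel (suc i) none′ (≤-trans b≤ (≤-reflexive (sym (+-suc fuel i))))
    where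
    none′ : ∀ j → 1 ≤ j → j ≤ suc i → ¬ P j
    none′ j 1≤j j≤ with m≤n⇒m<n∨m≡n j≤
    ... | inj₁ (s≤s j≤i) = none j 1≤j j≤i
    ... | inj₂ refl = ¬p

-- The single conflict chromatic number.

module _ (G : Graph) where
  open Graph G

  AlwaysConflictColorable : ℕ → Set
  AlwaysConflictColorable k = (c : LocalPartition G k) → ConflictColorable G k c

  ConflictFree : ∀ {k} → (Vertex → Vertex → Fin k) → (Vertex → Fin k) → Set
  ConflictFree c φ = ∀ x y → Adj x y → ¬ (φ x ≡ c x y × φ y ≡ c y x)

  -- A local partition with at least one colour extends to all ordered pairs of
  -- vertices, and functions on Fin order × Fin order can be enumerated.
  MatrixColorable : ℕ → Set
  MatrixColorable k = (c : Vertex → Vertex → Fin k) → Σ[ φ ∈ (Vertex → Fin k) ] ConflictFree c φ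

  alwaysConflict⇒matrix : ∀ {k} → AlwaysConflictColorable k → MatrixColorable k
  alwaysConflict⇒matrix h c with φ , free ← h (λ v (w , _) → c v w) = φ , free

  matrix⇒alwaysConflict : ∀ {k} → MatrixColorable (suc k) → AlwaysConflictColorable (suc k)
  matrix⇒alwaysConflict {k} h c = let φ , free = h total in φ , λ x y e (p , q) →
      free x y e (trans p (agrees x y e) , trans q (agrees y x (adj-sym x y e)))
    where
    total : Vertex → Vertex → Fin (suc k)
    total v w with T? (adj v w)
    ... | yes e = c v (w , e)
    -- Any colour would do, since `ConflictFree` constrains adjacent pairs only.
    ... | no  _ = zero
    agrees : ∀ v w (e : Adj v w) → c v (w , e) ≡ total v w
    agrees v w e with T? (adj v w)
    -- The partition takes the adjacency proof as an argument; uniqueness of such proofs identifies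
    -- the one found with the one given.
    ... | yes e′ = cong (λ e → c v (w , e)) (T-irrelevant e e′)
    ... | no ¬e  = contradiction e ¬e

  conflictFree-resp : ∀ {k} {c d : Vertex → Vertex → Fin k} {φ ψ} →
    (∀ x y → c x y ≡ d x y) → φ ≗ ψ → ConflictFree c φ → ConflictFree d ψ
  conflictFree-resp c≗d φ≗ψ free x y e (p , q) =
    free x y e (trans (φ≗ψ x) (trans p (sym (c≗d x y))) , trans (φ≗ψ y) (trans q (sym (c≗d y x))))

  conflictFree? : ∀ {k} (c : Vertex → Vertex → Fin k) φ → Dec (ConflictFree c φ)
  conflictFree? c φ = all? λ x → all? λ y → T? (adj x y) →-dec ¬? (φ x ≟ c x y ×-dec φ y ≟ c y x)

  matrixColorable? : ∀ k → Dec (MatrixColorable k)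
  matrixColorable? k = map′
    {A = (c : Fin (order * order) → Fin k) → Σ[ φ ∈ (Vertex → Fin k) ] ConflictFree (λ x y → c (combine x y)) φ}
    (λ h c → let φ , free = h (λ xy → uncurry c (remQuot order xy)) in
      φ , conflictFree-resp (λ x y → cong (uncurry c) (remQuot-combine x y)) (λ _ → refl) free)
    (λ h c → h (λ x y → c (combine x y)))
    (all-functions?
      (λ c≗d (φ , free) → φ , conflictFree-resp (λ x y → c≗d (combine x y)) (λ _ → refl) free)
      (λ c → any-function? (conflictFree-resp (λ _ _ → refl)) (conflictFree? (λ x y → c (combine x y)))))

  alwaysConflictColorable? : ∀ k → Dec (AlwaysConflictColorable (suc k))
  alwaysConflictColorable? k = map′ matrix⇒alwaysConflict alwaysConflict⇒matrix (matrixColorable? (suc k))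

  -- Only the first j colours are used, so a forbidden colour beyond them is never met and `cap` may
  -- replace it arbitrarily. Monotonicity turns failure at K into a lower bound on the least value.
  matrixColorable-mono : ∀ {j k} → 1 ≤ j → j ≤ k → MatrixColorable j → MatrixColorable k
  matrixColorable-mono {suc j} {k} _ j<k h c = let φ , free = h capped in (λ v → inject≤ (φ v) j<k) , λ x y e (p , q) →
      free x y e (recover (φ x) (c x y) p , recover (φ y) (c y x) q)
    where
    cap : Fin k → Fin (suc j)
    cap a with toℕ a <? suc j
    ... | yes a< = fromℕ< a<
    ... | no  _  = zero
    capped : Vertex → Vertex → Fin (suc j)
    capped x y = cap (c x y)
    recover : ∀ (b : Fin (suc j)) a → inject≤ b j<k ≡ a → b ≡ cap a
    recover b a refl with toℕ (inject≤ b j<k) <? suc j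
    ... | yes a< = toℕ-injective (sym (trans (toℕ-fromℕ< a<) (toℕ-inject≤ b j<k)))
    ... | no  a≮ = contradiction (subst (_< suc j) (sym (toℕ-inject≤ b j<k)) (toℕ<n b)) a≮

  few-pairs⇒matrixColorable : ∀ {k} → pairCount order < k * k → MatrixColorable k
  few-pairs⇒matrixColorable few c = let φ , free = conflict-free-choice c few in
    φ , λ x y e → free x y λ { refl → adj-irrefl x e }

  singleConflictChromaticNumber : ∀ b → 1 ≤ b → pairCount order < b * b →
    ∃[ χ ] (IsSingleConflictChromaticNumber G χ × χ ≤ b)
  singleConflictChromaticNumber (suc b) 1≤b few =
    let χ , least = leastPositive alwaysConflictColorable? (suc b) 1≤b always in
    χ , least , proj₂ (proj₂ least) (suc b) 1≤b always
    where
    always : AlwaysConflictColorable (suc b)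
    always = matrix⇒alwaysConflict (few-pairs⇒matrixColorable few)

-- The choice number.

unique-lookup-injective : ∀ {A : Set} {xs : List A} → Unique xs → ∀ i j → List.lookup xs i ≡ List.lookup xs j → i ≡ j
unique-lookup-injective (_ ∷ _)    zero    zero    _  = refl
unique-lookup-injective (x∉xs ∷ _) zero    (suc j) eq = contradiction eq (All.lookup x∉xs (∈-lookup j))
unique-lookup-injective (x∉xs ∷ _) (suc i) zero    eq = contradiction (sym eq) (All.lookup x∉xs (∈-lookup i))
unique-lookup-injective (_ ∷ u)    (suc i) (suc j) eq = cong suc (unique-lookup-injective u i j eq)

fresh-value : ∀ {m n} (f : Fin m → ℕ) → (∀ i j → f i ≡ f j → i ≡ j) → (g : Fin n → ℕ) → n < m →
  ∃[ i ] ∀ j → f i ≢ g j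
fresh-value f f-inj g n<m with any? (λ i → all? (λ j → ¬? (f i ≟ℕ g j)))
... | yes found = found
... | no  none  = contradiction (injective⇒≤ preimage-injective) (<⇒≱ n<m)
  where
  taken : ∀ i → ∃[ j ] f i ≡ g j
  taken i with any? (λ j → f i ≟ℕ g j)
  ... | yes p = p
  ... | no ¬p = contradiction (i , λ j eq → ¬p (j , eq)) none
  preimage-injective : ∀ {i i′} → proj₁ (taken i) ≡ proj₁ (taken i′) → i ≡ i′
  preimage-injective {i} {i′} eq =
    f-inj i i′ (trans (proj₂ (taken i)) (trans (cong g eq) (sym (proj₂ (taken i′)))))

distinct-choice : ∀ {n} (L : Fin n → List ℕ) → (∀ v → Unique (L v)) → (∀ v → n ≤ length (L v)) →
  Σ[ φ ∈ (Fin n → ℕ) ] (∀ x y → φ x ≡ φ y → x ≡ y) × (∀ v → φ v ∈ L v)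
distinct-choice {zero}  L unique long = (λ ()) , (λ ()) , λ ()
distinct-choice {suc n} L unique long
  with ψ , ψ-inj , ψ∈ ← distinct-choice (L ∘ suc) (unique ∘ suc) (λ v → <⇒≤ (long (suc v)))
  with i , fresh ← fresh-value (List.lookup (L zero)) (unique-lookup-injective (unique zero)) ψ (long zero) =
  φ , φ-inj , φ∈
  where
  φ : Fin (suc n) → ℕ
  φ zero    = List.lookup (L zero) i
  φ (suc v) = ψ v
  φ-inj : ∀ x y → φ x ≡ φ y → x ≡ y
  φ-inj zero    zero    _  = refl
  φ-inj zero    (suc y) eq = contradiction eq (fresh y)
  φ-inj (suc x) zero    eq = contradiction (sym eq) (fresh x)
  φ-inj (suc x) (suc y) eq = cong suc (ψ-inj x y eq)
  φ∈ : ∀ v → φ v ∈ L v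
  φ∈ zero    = ∈-lookup i
  φ∈ (suc v) = ψ∈ v

module _ (G : Graph) where
  open Graph G

  choosable-order : Choosable G order
  choosable-order L unique long with φ , φ-inj , φ∈ ← distinct-choice L unique long =
    φ , (λ x y e eq → adj-irrefl x (subst (Adj x) (sym (φ-inj x y eq)) e)) , φ∈

  -- Only the equality pattern of the k · order list entries matters, so the
  -- colours can be drawn from a set of that size.
  RowInjective : ∀ k {q} → (Fin (order * k) → Fin q) → Set
  RowInjective k L = ∀ (v : Vertex) (i j : Fin k) → L (combine v i) ≡ L (combine v j) → i ≡ j

  Selection : ∀ k {q} → (Fin (order * k) → Fin q) → Set
  Selection k L = Σ[ φ ∈ (Vertex → Fin k) ] ∀ x y → Adj x y → L (combine x (φ x)) ≢ L (combine y (φ y))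

  FinitelyChoosable : ℕ → Set
  FinitelyChoosable k = (L : Fin (order * k) → Fin (order * k)) → RowInjective k L → Selection k L

  finitelyChoosable? : ∀ k → Dec (FinitelyChoosable k)
  finitelyChoosable? k = all-functions?
      (λ f≗g select inj →
        let φ , proper = select (λ v i j eq → inj v i j (trans (sym (f≗g _)) (trans eq (f≗g _)))) in
        φ , λ x y e eq → proper x y e (trans (f≗g _) (trans eq (sym (f≗g _)))))
      (λ L → (all? {order} λ v → all? {k} λ i → all? λ j → L (combine v i) ≟ L (combine v j) →-dec i ≟ j)
        →-dec any-function?
          (λ φ≗ψ proper x y e eq → proper x y e
            (trans (cong (L ∘ combine x) (φ≗ψ x)) (trans eq (cong (L ∘ combine y) (sym (φ≗ψ y))))))
          (λ φ → all? λ x → all? λ y → T? (adj x y) →-dec ¬? (L (combine x (φ x)) ≟ L (combine y (φ y)))))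

  choosable⇒finitely : ∀ {k} → Choosable G k → FinitelyChoosable k
  choosable⇒finitely {k} h L inj
    with φ , proper , φ∈ ← h (λ v → List.tabulate (toℕ ∘ L ∘ combine v))
      (λ v → tabulate⁺ (λ eq → inj v _ _ (toℕ-injective eq)))
      (λ v → ≤-reflexive (sym (Listₚ.length-tabulate (toℕ ∘ L ∘ combine v)))) =
    proj₁ ∘ position , λ x y e eq → proper x y e
      (trans (proj₂ (position x)) (trans (cong toℕ eq) (sym (proj₂ (position y)))))
    where
    position : ∀ v → ∃[ i ] φ v ≡ toℕ (L (combine v i))
    position v = ∈-tabulate⁻ (φ∈ v)

  -- Each colour is coded by a position where it occurs among the first k entries of the lists.
  -- Codes agree exactly when the colours do, so a selection for the coded lists is proper for the
  -- original ones.
  finitely⇒choosable : ∀ {k} → FinitelyChoosable k → Choosable G k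
  finitely⇒choosable {k} h L unique long = color , proper , λ v → ∈-lookup (inject≤ (φ v) (long v))
    where
    entry : Vertex → Fin k → ℕ
    entry v i = List.lookup (L v) (inject≤ i (long v))
    value : Fin (order * k) → ℕ
    value p = uncurry entry (remQuot k p)
    value-combine : ∀ v i → value (combine v i) ≡ entry v i
    value-combine v i = cong (uncurry entry) (remQuot-combine v i)
    find : ∀ c → Dec (∃[ q ] value q ≡ c)
    find c = any? (λ q → value q ≟ℕ c)
    found-or : ∀ {c} → Dec (∃[ q ] value q ≡ c) → Fin (order * k) → Fin (order * k)
    found-or (yes (q , _)) p = q
    -- This default is never returned when c is the value at p, since p is then a witness itself.
    found-or (no  _)       p = p
    code : Fin (order * k) → Fin (order * k)
    code p = found-or (find (value p)) p
    value-found-or : ∀ {c} (d : Dec (∃[ q ] value q ≡ c)) p → value p ≡ c → value (found-or d p) ≡ c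
    value-found-or (yes (_ , eq)) p _  = eq
    value-found-or (no  _)        p eq = eq
    found-or-irrelevant : ∀ {c} (d : Dec (∃[ q ] value q ≡ c)) p p′ → value p ≡ c → found-or d p ≡ found-or d p′
    found-or-irrelevant (yes _) p p′ eq = refl
    found-or-irrelevant (no ¬d) p p′ eq = contradiction (p , eq) ¬d
    code-cong : ∀ p p′ → value p ≡ value p′ → code p ≡ code p′
    code-cong p p′ eq = trans (found-or-irrelevant (find (value p)) p p′ refl)
      (cong (λ c → found-or (find c) p′) eq)
    code-injective : ∀ p p′ → code p ≡ code p′ → value p ≡ value p′
    code-injective p p′ eq = trans (sym (value-found-or (find (value p)) p refl))
      (trans (cong value eq) (value-found-or (find (value p′)) p′ refl))
    selection : Selection k code
    selection = h code λ v i j eq → inject≤-injective (long v) (long v) i j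
      (unique-lookup-injective (unique v) _ _
        (trans (sym (value-combine v i)) (trans (code-injective _ _ eq) (value-combine v j))))
    φ = proj₁ selection
    color : Vertex → ℕ
    color v = entry v (φ v)
    proper : ProperColoring G color
    proper x y e eq = proj₂ selection x y e
      (code-cong _ _ (trans (value-combine x (φ x)) (trans eq (sym (value-combine y (φ y))))))

  choosable? : ∀ k → Dec (Choosable G k)
  choosable? k = map′ finitely⇒choosable choosable⇒finitely (finitelyChoosable? k)

  choiceNumber : ∀ b → 1 ≤ b → Choosable G b → ∃[ ch ] (IsChoiceNumber G ch × ch ≤ b)
  choiceNumber b 1≤b choosable =
    let ch , least = leastPositive (choosable? ∘ suc) b 1≤b choosable in
    ch , least , proj₂ (proj₂ least) b 1≤b choosable

-- Complete bipartite graphs that are not conflict colourable.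

side : ∀ n → Fin (n + n) → Fin 2
side n v = [ (λ _ → zero) , (λ _ → suc zero) ]′ (splitAt n v)

-- Serves both families: `side n` yields K_{n,n}, and `id` yields the complete graph.
completeMultipartite : ∀ {N r} → (Fin N → Fin r) → Graph
completeMultipartite {N} part = record
  { order      = N
  ; adj        = λ x y → isNo (part x ≟ part y)
  ; adj-sym    = λ x y e → fromWitnessFalse {a? = part y ≟ part x} (toWitnessFalse e ∘ sym)
  ; adj-irrefl = λ x e → toWitnessFalse {a? = part x ≟ part x} e refl
  }

module _ {n K : ℕ} where

  fstEnd sndEnd : Fin (n * n) → Fin (n + n)
  fstEnd e = proj₁ (remQuot {n} n e) ↑ˡ n
  sndEnd e = n ↑ʳ proj₂ (remQuot {n} n e)

  endColors : (Fin (n + n) → Fin K) → Fin (n * n) → Fin (K * K)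
  endColors φ e = combine (φ (fstEnd e)) (φ (sndEnd e))

  -- The items are the colourings s, the coordinates the n² edges. All but one of the K² forbidden
  -- pairs at an edge miss a given colouring, so the hypothesis is the first-moment condition; a
  -- choice hitting every colouring leaves none conflict-free.
  bipartite-not-matrixColorable : K ^ (n + n) * pred (K * K) ^ (n * n) < (K * K) ^ (n * n) →
    ¬ MatrixColorable (completeMultipartite (side n)) K
  bipartite-not-matrixColorable few h = free x y adjacent (sym at-x , sym at-y)
    where
    agrees? : ∀ e l s → Dec (l ≡ endColors (finToFun s) e)
    agrees? e l s = l ≟ endColors (finToFun s) e

    total : sum (λ s → prod (λ e → misses agrees? e s)) < (K * K) ^ (n * n)
    total = begin-strict
      sum (λ s → prod (λ e → misses agrees? e s))
        ≡⟨ sum-cong-≗ {K ^ (n + n)} (λ s → trans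
             (prod-cong-≗ {n * n} (λ e → sum-unless≡ (endColors (finToFun s) e)))
             (prod-const (n * n) (pred (K * K)))) ⟩
      sum {K ^ (n + n)} (λ _ → pred (K * K) ^ (n * n))
        ≡⟨ sum-const (K ^ (n + n)) _ ⟩
      K ^ (n + n) * pred (K * K) ^ (n * n)
        <⟨ few ⟩
      (K * K) ^ (n * n) ∎
      where open ≤-Reasoning

    choice : Σ[ d ∈ (Fin (n * n) → Fin (K * K)) ] ∀ s → ∃[ e ] d e ≡ endColors (finToFun s) e
    choice = hitting-choice agrees? total
    d = proj₁ choice

    end : Fin n ⊎ Fin n → Fin n
    end = [ id , id ]′

    color : Fin n ⊎ Fin n → Fin n ⊎ Fin n → Fin K
    -- Each endpoint is told its half of the forbidden pair. `end` drops the side tag, so that pairs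
    -- within one side, which are no edges, also get a value.
    color (inj₁ i) w = proj₁ (remQuot {K} K (d (combine i (end w))))
    color (inj₂ j) w = proj₂ (remQuot {K} K (d (combine (end w) j)))

    coloring = h (λ v w → color (splitAt n v) (splitAt n w))
    φ = proj₁ coloring
    free = proj₂ coloring

    hit = proj₂ choice (funToFin φ)
    e = proj₁ hit
    i = proj₁ (remQuot {n} n e)
    j = proj₂ (remQuot {n} n e)
    x = fstEnd e
    y = sndEnd e

    d-ij : remQuot {K} K (d (combine i j)) ≡ (φ x , φ y)
    d-ij = begin
      remQuot K (d (combine i j))       ≡⟨ cong (remQuot {K} K ∘ d) (combine-remQuot {n} n e) ⟩
      remQuot K (d e)                   ≡⟨ cong (remQuot {K} K) (proj₂ hit) ⟩
      remQuot K (combine (finToFun (funToFin φ) x) (finToFun (funToFin φ) y))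
                                        ≡⟨ remQuot-combine {K} {K} _ _ ⟩
      (finToFun (funToFin φ) x , finToFun (funToFin φ) y)
                                        ≡⟨ cong₂ _,_ (finToFun-funToFin φ x) (finToFun-funToFin φ y) ⟩
      (φ x , φ y)                       ∎
      where open ≡-Reasoning

    at-x : color (splitAt n x) (splitAt n y) ≡ φ x
    at-x = trans (cong₂ color (splitAt-↑ˡ n i n) (splitAt-↑ʳ n n j)) (cong proj₁ d-ij)

    at-y : color (splitAt n y) (splitAt n x) ≡ φ y
    at-y = trans (cong₂ color (splitAt-↑ʳ n n j) (splitAt-↑ˡ n i n)) (cong proj₂ d-ij)

    sides-differ : side n x ≢ side n y
    sides-differ eq with () ← trans (sym (cong [ _ , _ ]′ (splitAt-↑ˡ n i n)))
                              (trans eq (cong [ _ , _ ]′ (splitAt-↑ʳ n n j)))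

    adjacent = fromWitnessFalse {a? = side n x ≟ side n y} sides-differ

-- Choosability of bipartite graphs.

absence : ∀ {p} {P : Set p} → Dec P → ℕ
absence d = if does d then 1 else 2

-- `absence` counts the sides to which a colour can be given without serving the vertex: one if it
-- is listed, both if not. So each listed colour halves the product; `single` moves the missing
-- factor 2 to the index of the head colour.
absence-prod : ∀ M xs → Unique xs → (∀ {c} → c ∈ xs → c < M) →
  prod {M} (λ i → absence (toℕ i ∈? xs)) * 2 ^ length xs ≤ 2 ^ M
absence-prod M [] _ _ = ≤-reflexive (trans (*-identityʳ _) (prod-const M 2))
absence-prod M (x ∷ xs) (x∉ ∷ u) bounded = begin
  prod (absences (x ∷ xs)) * (2 * 2 ^ length xs)                         ≡⟨ *-assoc (prod (absences (x ∷ xs))) 2 _ ⟨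
  prod (absences (x ∷ xs)) * 2 * 2 ^ length xs                           ≡⟨ cong (λ z → prod (absences (x ∷ xs)) * z * 2 ^ length xs) (prod-single x′ 2) ⟨
  prod (absences (x ∷ xs)) * prod single * 2 ^ length xs                 ≡⟨ cong (_* 2 ^ length xs) (prod-distrib-* (absences (x ∷ xs)) single) ⟨
  prod (λ i → absences (x ∷ xs) i * single i) * 2 ^ length xs            ≤⟨ *-monoˡ-≤ (2 ^ length xs) (prod-mono bound) ⟩
  prod (absences xs) * 2 ^ length xs                                     ≤⟨ absence-prod M xs u (bounded ∘ there) ⟩
  2 ^ M                                                                 ∎
  where
  open ≤-Reasoning
  x′ : Fin M
  x′ = fromℕ< (bounded (here refl))
  absences : List ℕ → Fin M → ℕ
  absences xs i = absence (toℕ i ∈? xs)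
  single : Fin M → ℕ
  single i = if does (i ≟ x′) then 2 else 1
  bound : ∀ i → absences (x ∷ xs) i * single i ≤ absences xs i
  bound i = cases (i ≟ x′) (toℕ i ∈? (x ∷ xs)) (toℕ i ∈? xs)
    where
    cases : (d : Dec (i ≡ x′)) (a : Dec (toℕ i ∈ x ∷ xs)) (b : Dec (toℕ i ∈ xs)) →
      absence a * (if does d then 2 else 1) ≤ absence b
    cases (yes refl) _ (yes i∈) =
      contradiction (sym (toℕ-fromℕ< _)) (All.lookup x∉ i∈)
    cases (yes refl) (yes _) (no _) = ≤-refl
    cases (yes refl) (no i∉) (no _) = contradiction (here (toℕ-fromℕ< _)) i∉
    cases (no _) (yes _) (yes _) = ≤-refl
    cases (no _) (yes _) (no _)  = s≤s z≤n
    cases (no _) (no i∉) (yes i∈) = contradiction (there i∈) i∉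
    cases (no _) (no _) (no _) = ≤-refl

module _ {N : ℕ} (part : Fin N → Fin 2) where

  -- Of all assignments of M colours to two sides, at most a fraction 1/2^t misses a given vertex,
  -- so on average fewer than one vertex is missed. A colour serves one side only, which makes the
  -- result proper.
  bipartite-list-coloring : ∀ {t} M → N < 2 ^ t → (L : Fin N → List ℕ) → (∀ v → Unique (L v)) →
    (∀ v → t ≤ length (L v)) → (∀ v {c} → c ∈ L v → c < M) →
    ∃[ φ ] ProperColoring (completeMultipartite part) φ × (∀ v → φ v ∈ L v)
  bipartite-list-coloring {t} M N<2^t L unique long bounded =
    φ , (λ x y e eq → toWitnessFalse {a? = part x ≟ part y} e (same-part x y eq)) , φ∈
    where
    Served : Fin M → Fin 2 → Fin N → Set
    Served i b v = toℕ i ∈ L v × b ≡ part v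

    served? : ∀ i b v → Dec (Served i b v)
    served? i b v = toℕ i ∈? L v ×-dec b ≟ part v

    misses≤absence : ∀ i v → misses served? i v ≤ absence (toℕ i ∈? L v)
    misses≤absence i v = bound (toℕ i ∈? L v)
      where
      bound : (d : Dec (toℕ i ∈ L v)) → sum (λ b → unless (d ×-dec b ≟ part v)) ≤ absence d
      bound (yes _) = ≤-reflexive (sum-unless≡ (part v))
      bound (no _)  = ≤-refl

    total : sum (λ v → prod (λ i → misses served? i v)) < 2 ^ M
    total = *-cancelʳ-< (2 ^ t) _ _ $ begin-strict
      sum F * 2 ^ t                ≡⟨ *-distribʳ-sum (2 ^ t) F ⟩
      sum (λ v → F v * 2 ^ t)      ≤⟨ sum-mono (λ v → ≤-trans
                                       (*-mono-≤ (prod-mono (λ i → misses≤absence i v)) (^-monoʳ-≤ 2 (long v)))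
                                       (absence-prod M (L v) (unique v) (bounded v))) ⟩
      sum {N} (λ _ → 2 ^ M)        ≡⟨ sum-const N (2 ^ M) ⟩
      N * 2 ^ M                    <⟨ *-monoˡ-< (2 ^ M) {{m^n≢0 2 M}} N<2^t ⟩
      2 ^ t * 2 ^ M                ≡⟨ *-comm (2 ^ t) (2 ^ M) ⟩
      2 ^ M * 2 ^ t                ∎
      where
      open ≤-Reasoning
      F : Fin N → ℕ
      F v = prod (λ i → misses served? i v)

    choice : Σ[ f ∈ (Fin M → Fin 2) ] ∀ v → ∃[ i ] Served i (f i) v
    choice = hitting-choice served? total
    f = proj₁ choice
    pick : Fin N → Fin M
    pick v = proj₁ (proj₂ choice v)
    φ : Fin N → ℕ
    φ v = toℕ (pick v)
    φ∈ : ∀ v → φ v ∈ L v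
    φ∈ v = proj₁ (proj₂ (proj₂ choice v))
    pick-part : ∀ v → f (pick v) ≡ part v
    pick-part v = proj₂ (proj₂ (proj₂ choice v))
    same-part : ∀ x y → φ x ≡ φ y → part x ≡ part y
    same-part x y eq = trans (sym (pick-part x)) (trans (cong f (toℕ-injective eq)) (pick-part y))

  bipartite-choosable : ∀ {t} → N < 2 ^ t → Choosable (completeMultipartite part) t
  bipartite-choosable N<2^t L unique long =
    -- `M` is one more than a bound on all listed colours.
    bipartite-list-coloring (suc (max 0 colors)) N<2^t L unique long
      (λ v c∈ → s≤s (All.lookup (xs≤max 0 colors) (∈-concat⁺′ c∈ (∈-tabulate⁺ v))))
    where
    colors = List.concat (List.tabulate L)

-- Numerical estimates.

bernoulli : ∀ p m → p ^ suc m + suc m * p ^ m ≤ suc p ^ suc m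
bernoulli p zero    = ≤-reflexive (solve 1 (λ p → p :* con 1 :+ con 1 := (con 1 :+ p) :* con 1) refl p)
  where open +-*-Solver
bernoulli p (suc m) = begin
  p * (p * q) + suc (suc m) * (p * q)              ≤⟨ m≤m+n _ (suc m * q) ⟩
  p * (p * q) + suc (suc m) * (p * q) + suc m * q  ≡⟨ solve 3 (λ p q m →
      p :* (p :* q) :+ (con 2 :+ m) :* (p :* q) :+ (con 1 :+ m) :* q
      := (con 1 :+ p) :* (p :* q :+ (con 1 :+ m) :* q)) refl p q m ⟩
  suc p * (p * q + suc m * q)                      ≤⟨ *-monoʳ-≤ (suc p) (bernoulli p m) ⟩
  suc p * suc p ^ suc m                            ∎
  where
  open ≤-Reasoning
  open +-*-Solver
  q = p ^ m

-- This is (1 - 1/Q)^Q ≤ 1/2: with p = Q - 1, the first two binomial terms of Q^Q are p^Q and Q p^p,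
-- each at least p^Q.
double-pred-power : ∀ Q .{{_ : NonZero Q}} → 2 * pred Q ^ Q ≤ Q ^ Q
double-pred-power (suc p) = begin
  2 * p ^ suc p                        ≡⟨ cong (p ^ suc p ℕ.+_) (+-identityʳ _) ⟩
  p ^ suc p + p * p ^ p                ≤⟨ +-monoʳ-≤ (p ^ suc p) (*-monoˡ-≤ (p ^ p) (n≤1+n p)) ⟩
  p ^ suc p + suc p * p ^ p            ≤⟨ bernoulli p p ⟩
  suc p ^ suc p                        ∎
  where open ≤-Reasoning

*-^-distrib : ∀ a b n → (a * b) ^ n ≡ a ^ n * b ^ n
*-^-distrib a b zero    = refl
*-^-distrib a b (suc n) = trans (cong (a * b *_) (*-^-distrib a b n))
  (solve 4 (λ a b x y → a :* b :* (x :* y) := a :* x :* (b :* y)) refl a b (a ^ n) (b ^ n))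
  where open +-*-Solver

2^a-pred-power : ∀ Q .{{_ : NonZero Q}} a → 2 ^ a * pred Q ^ (Q * a) ≤ Q ^ (Q * a)
2^a-pred-power Q a = begin
  2 ^ a * pred Q ^ (Q * a)    ≡⟨ cong (2 ^ a *_) (^-*-assoc (pred Q) Q a) ⟨
  2 ^ a * (pred Q ^ Q) ^ a    ≡⟨ *-^-distrib 2 (pred Q ^ Q) a ⟨
  (2 * pred Q ^ Q) ^ a        ≤⟨ ^-monoˡ-≤ a (double-pred-power Q) ⟩
  (Q ^ Q) ^ a                 ≡⟨ ^-*-assoc Q Q a ⟩
  Q ^ (Q * a)                 ∎
  where open ≤-Reasoning

n<2^n : ∀ n → n < 2 ^ n
n<2^n zero    = s≤s z≤n
n<2^n (suc n) = begin-strict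
  suc n              <⟨ s≤s (n<2^n n) ⟩
  1 + 2 ^ n          ≤⟨ +-monoˡ-≤ (2 ^ n) (m^n>0 2 n) ⟩
  2 ^ n + 2 ^ n      ≡⟨ cong (2 ^ n ℕ.+_) (+-identityʳ _) ⟨
  2 ^ suc n          ∎
  where open ≤-Reasoning

counting-bound : ∀ Q K N a → 1 < Q → K ^ N < 2 ^ a → K ^ N * pred Q ^ (Q * a) < Q ^ (Q * a)
counting-bound Q@(suc p@(suc _)) K N a (s≤s (s≤s _)) K^N<2^a = <-≤-trans
  (*-monoˡ-< (p ^ (Q * a)) {{m^n≢0 p (Q * a)}} K^N<2^a) (2^a-pred-power Q a)

-- The number a satisfies n² = K² a, since 6r + 2 = 2r + (4r + 2). What remains is K^(2n) < 2^a,
-- that is r 2^(3r+2) < 2^(4r+2), which follows from r < 2^r.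
bipartite-not-2^r-colorable : ∀ r → 1 ≤ r →
  let n = 2 ^ (3 * r + 1) in ¬ MatrixColorable (completeMultipartite (side n)) (2 ^ r)
bipartite-not-2^r-colorable r 1≤r = bipartite-not-matrixColorable {n} {K}
    (subst (λ z → K ^ (n + n) * pred (K * K) ^ z < (K * K) ^ z) (sym n*n≡)
      (counting-bound (K * K) K (n + n) a 1<K*K few))
  where
  open +-*-Solver
  n = 2 ^ (3 * r + 1)
  K = 2 ^ r
  a = 2 ^ (4 * r + 2)
  n*n≡ : n * n ≡ K * K * a
  n*n≡ = begin
    n * n                                ≡⟨ ^-distribˡ-+-* 2 (3 * r + 1) (3 * r + 1) ⟨
    2 ^ (3 * r + 1 + (3 * r + 1))        ≡⟨ cong (2 ^_) (solve 1 (λ r →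
        con 3 :* r :+ con 1 :+ (con 3 :* r :+ con 1) := r :+ r :+ (con 4 :* r :+ con 2)) refl r) ⟩
    2 ^ (r + r + (4 * r + 2))            ≡⟨ ^-distribˡ-+-* 2 (r + r) (4 * r + 2) ⟩
    2 ^ (r + r) * a                      ≡⟨ cong (_* a) (^-distribˡ-+-* 2 r r) ⟩
    K * K * a                            ∎
    where open ≡-Reasoning
  1<K*K : 1 < K * K
  1<K*K = <-≤-trans (≤-<-trans 1≤r (n<2^n r)) (m≤m*n K K {{m^n≢0 2 r}})
  few : K ^ (n + n) < 2 ^ a
  few = begin-strict
    (2 ^ r) ^ (n + n)                    ≡⟨ ^-*-assoc 2 r (n + n) ⟩
    2 ^ (r * (n + n))                    <⟨ ^-monoʳ-< 2 (s≤s (s≤s z≤n)) exponents ⟩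
    2 ^ a                                ∎
    where
    open ≤-Reasoning
    exponents : r * (n + n) < a
    exponents = begin-strict
      r * (n + n)                        ≡⟨ cong (λ z → r * (n + z)) (+-identityʳ n) ⟨
      r * 2 ^ (1 + (3 * r + 1))          <⟨ *-monoˡ-< (2 ^ (1 + (3 * r + 1))) {{m^n≢0 2 (1 + (3 * r + 1))}} (n<2^n r) ⟩
      2 ^ r * 2 ^ (1 + (3 * r + 1))      ≡⟨ ^-distribˡ-+-* 2 r (1 + (3 * r + 1)) ⟨
      2 ^ (r + (1 + (3 * r + 1)))        ≡⟨ cong (2 ^_) (solve 1 (λ r →
          r :+ (con 1 :+ (con 3 :* r :+ con 1)) := con 4 :* r :+ con 2) refl r) ⟩
      2 ^ (4 * r + 2)                    ∎

-- The two gaps.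

matrixColorable-threshold : ∀ G {K χ} → ¬ MatrixColorable G K → IsSingleConflictChromaticNumber G χ → K < χ
matrixColorable-threshold G not (1≤χ , colorable , _) =
  ≰⇒> λ χ≤K → not (matrixColorable-mono G 1≤χ χ≤K (alwaysConflict⇒matrix G colorable))

-- Makes n colours suffice on n vertices, which bounds the search for the least value.
pairCount<square : ∀ n → 1 ≤ n → pairCount n < n * n
pairCount<square n 1≤n = begin-strict
  pairCount n              ≤⟨ m≤m+n (pairCount n) _ ⟩
  2 * pairCount n          <⟨ m<m+n (2 * pairCount n) 1≤n ⟩
  2 * pairCount n + n      ≡⟨ pairCount-double n ⟩
  n * n                    ∎
  where open ≤-Reasoning

gap⇒≥ : ∀ k {a b} → k + b ≤ a → ℤ.+ a ℤ.- ℤ.+ b ℤ.≥ ℤ.+ k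
gap⇒≥ k {a} {b} k+b≤a = subst (ℤ.+ k ℤ.≤_)
  (sym (trans (ℤₚ.m-n≡m⊖n a b) (ℤₚ.⊖-≥ (m+n≤o⇒n≤o k k+b≤a))))
  (ℤ.+≤+ (m+n≤o⇒m≤o∸n k k+b≤a))

conflict-exceeds-choice : ∀ k → Σ[ G ∈ Graph ] ∃[ χ ] ∃[ ch ]
  (IsSingleConflictChromaticNumber G χ × IsChoiceNumber G ch × k + ch ≤ χ)
conflict-exceeds-choice k =
  let χ , isχ , _ = singleConflictChromaticNumber G (n + n) 1≤2n (pairCount<square (n + n) 1≤2n)
      ch , isCh , ch≤t = choiceNumber G t (m≤n+m 1 (3 * r + 2)) (bipartite-choosable (side n) 2n<2^t)
  in G , χ , ch , isχ , isCh , ≤-trans (+-monoʳ-≤ k ch≤t)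
       (≤-trans logarithmic (<⇒≤ (matrixColorable-threshold G (bipartite-not-2^r-colorable r 1≤r) isχ)))
  where
  -- With this shift 2^r is at least 32 (k + 1), above k + t = 4k + 18.
  r = k + 5
  n = 2 ^ (3 * r + 1)
  -- 2n = 2^(3r+2) has to stay strictly below 2^t.
  t = 3 * r + 2 + 1
  G = completeMultipartite (side n)
  1≤r : 1 ≤ r
  1≤r = ≤-trans (s≤s z≤n) (m≤n+m 5 k)
  1≤2n : 1 ≤ n + n
  1≤2n = ≤-trans (m^n>0 2 (3 * r + 1)) (m≤m+n n n)
  2n<2^t : n + n < 2 ^ t
  2n<2^t = begin-strict
    n + n                     ≡⟨ cong (n ℕ.+_) (+-identityʳ n) ⟨
    2 ^ (1 + (3 * r + 1))     <⟨ ^-monoʳ-< 2 (s≤s (s≤s z≤n)) (≤-reflexive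
        (solve 1 (λ r → con 2 :+ (con 3 :* r :+ con 1) := con 3 :* r :+ con 2 :+ con 1) refl r)) ⟩
    2 ^ t                     ∎
    where
    open ≤-Reasoning
    open +-*-Solver
  logarithmic : k + t ≤ 2 ^ r
  logarithmic = begin
    k + t                       ≡⟨ solve 1 (λ k → k :+ (con 3 :* (k :+ con 5) :+ con 2 :+ con 1) := con 4 :* k :+ con 18) refl k ⟩
    4 * k + 18                  ≤⟨ m≤m+n (4 * k + 18) (28 * k + 14) ⟩
    4 * k + 18 + (28 * k + 14)  ≡⟨ solve 1 (λ k → con 4 :* k :+ con 18 :+ (con 28 :* k :+ con 14) := (con 1 :+ k) :* con 32) refl k ⟩
    suc k * 2 ^ 5               ≤⟨ *-monoˡ-≤ (2 ^ 5) (n<2^n k) ⟩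
    2 ^ k * 2 ^ 5               ≡⟨ ^-distribˡ-+-* 2 k 5 ⟨
    2 ^ r                       ∎
    where
    open ≤-Reasoning
    open +-*-Solver

-- From above, n lists of size n have distinct representatives. From below, equal lists of size j
-- force an injection of the vertices into j colours.
complete-choiceNumber : ∀ n → 1 ≤ n → IsChoiceNumber (completeMultipartite {n} id) n
complete-choiceNumber n 1≤n = 1≤n , choosable-order (completeMultipartite id) , minimal
  where
  minimal : ∀ j → 1 ≤ j → Choosable (completeMultipartite {n} id) j → n ≤ j
  minimal j _ choosable = injective⇒≤ color-injective
    where
    coloring = choosable (λ _ → upTo j) (λ _ → upTo⁺ j) (λ _ → ≤-reflexive (sym (Listₚ.length-upTo j)))
    φ = proj₁ coloring
    φ<j : ∀ v → φ v < j
    φ<j v = ∈-upTo⁻ (proj₂ (proj₂ coloring) v)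
    color-injective : ∀ {x y} → fromℕ< (φ<j x) ≡ fromℕ< (φ<j y) → x ≡ y
    color-injective {x} {y} eq = decidable-stable (x ≟ y) λ x≢y →
      proj₁ (proj₂ coloring) x y (fromWitnessFalse x≢y)
        (trans (sym (toℕ-fromℕ< (φ<j x))) (trans (cong toℕ eq) (toℕ-fromℕ< (φ<j y))))

choice-exceeds-conflict : ∀ k → 1 ≤ k → Σ[ H ∈ Graph ] ∃[ χ ] ∃[ ch ]
  (IsSingleConflictChromaticNumber H χ × IsChoiceNumber H ch × k + χ ≤ ch)
choice-exceeds-conflict k 1≤k =
  let χ , isχ , χ≤3k = singleConflictChromaticNumber H (3 * k) (≤-trans 1≤k (m≤m+n k _)) few
  in H , χ , 4 * k , isχ , complete-choiceNumber (4 * k) (≤-trans 1≤k (m≤m+n k _)) , +-monoʳ-≤ k χ≤3k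
  where
  open ≤-Reasoning
  open +-*-Solver
  H = completeMultipartite {4 * k} id
  few : pairCount (4 * k) < 3 * k * (3 * k)
  few = *-cancelˡ-< 2 _ _ $ begin-strict
    2 * pairCount (4 * k)            ≤⟨ m≤m+n _ (4 * k) ⟩
    2 * pairCount (4 * k) + 4 * k    ≡⟨ pairCount-double (4 * k) ⟩
    -- The slack 2k² = 18k² - 16k² is positive because k ≥ 1.
    4 * k * (4 * k)                  <⟨ m<m+n (4 * k * (4 * k)) (*-mono-≤ {1} {2 * k} (≤-trans 1≤k (m≤m+n k _)) 1≤k) ⟩
    4 * k * (4 * k) + 2 * k * k      ≡⟨ solve 1 (λ k →
        con 4 :* k :* (con 4 :* k) :+ con 2 :* k :* k := con 2 :* (con 3 :* k :* (con 3 :* k))) refl k ⟩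
    2 * (3 * k * (3 * k))            ∎

proposition1p1 : (k : ℕ) → 1 ≤ℕ k →
    Σ[ G ∈ Graph ] Σ[ H ∈ Graph ]
    (∃[ χG ] ∃[ chG ]
    (IsSingleConflictChromaticNumber G χG × IsChoiceNumber G chG × (+ χG) - (+ chG) ≥ + k))
    ×
    (∃[ χH ] ∃[ chH ]
    (IsSingleConflictChromaticNumber H χH × IsChoiceNumber H chH × (+ chH) - (+ χH) ≥ + k))
proposition1p1 k 1≤k =
  let G , χG , chG , isχG , isChG , gapG = conflict-exceeds-choice k
      H , χH , chH , isχH , isChH , gapH = choice-exceeds-conflict k 1≤k
  in G , H , (χG , chG , isχG , isChG , gap⇒≥ k gapG) , (χH , chH , isχH , isChH , gap⇒≥ k gapH)
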